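{- For all positive integers $r$ and $s$ with $r\ge 2$, there is a constant $n_0=n_0(r,s)$ such that if $n\ge n_0$ and $G$ is an $n$-vertex $r$-digraph with $|E(G)|\ge\left(1-\frac1r\right)n_{(r)}$, then $P^{(r)}_s\subseteq G$.
   Context: An $r$-digraph $G$ consists of a finite vertex set $V(G)$ and an edge set $E(G)$ whose elements are ordered lists of $r$ distinct vertices. The tight path $P^{(r)}_s$ is the $r$-digraph with $s$ distinct vertices $v_1,\ldots,v_s$ whose edges are exactly the lists of $r$ consecutive vertices $(v_i,\ldots,v_{i+r-1})$, $1\le i\le s-r+1$ (no edges if $s<r$). For $r$-digraphs $F,G$, $F\subseteq G$ means there is an injection $h:V(F)\to V(G)$ such that $(u_1,\ldots,u_r)\in E(F)$ implies $(h(u_1),\ldots,h(u_r))\in E(G)$. $n_{(r)}=n(n-1)\cdots(n-r+1)$ is the falling factorial. -}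

module Defs where

open import Data.Fin.Base using (Fin; zero; toℕ; fromℕ<)
open import Data.Fin.Properties using (toℕ<n; toℕ-injective; toℕ-fromℕ<)
open import Data.List.Base using (List; length; allFin)
import Data.List.Base as List
open import Data.List.Membership.Propositional using (_∈_)
open import Data.List.Relation.Unary.All using (All; universal)
import Data.List.Relation.Unary.All.Properties as All
import Data.List.Relation.Unary.Unique.Propositional as List
import Data.List.Relation.Unary.Unique.Propositional.Properties as ListUnique
open import Data.Nat.Base using (ℕ; suc; _+_; _∸_; _<_; NonZero)
open import Data.Nat.Properties
  using (+-monoʳ-<; +-cancelˡ-≡; +-cancelʳ-≡; <-≤-trans; <⇒≤; m<1+n⇒m≤n; m<n⇒n≢0;
         m∸n≢0⇒n<m; m≤o∸n⇒m+n≤o)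
open import Data.Product.Base using (Σ-syntax; _×_)
open import Data.Vec.Base using (Vec; tabulate; lookup)
import Data.Vec.Base as Vec
open import Data.Vec.Properties using (lookup∘tabulate)
import Data.Vec.Relation.Unary.Unique.Propositional as Vec
import Data.Vec.Relation.Unary.Unique.Propositional.Properties as VecUnique
open import Function.Definitions using (Injective)
open import Relation.Binary.PropositionalEquality
  using (_≡_; refl; sym; trans; cong)

-- An r-digraph on the vertex set Fin n.  The order of the list `edges` is
-- irrelevant; having no repetitions, it represents a finite set.
record Digraph (r n : ℕ) : Set where
  field
    edges          : List (Vec (Fin n) r)
    edges-unique   : List.Unique edges
    edges-distinct : All Vec.Unique edges

open Digraph public

∣E_∣ : ∀ {r n} → Digraph r n → ℕ
∣E G ∣ = length (edges G)

infix 4 _⊆_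

_⊆_ : ∀ {r m n} → Digraph r m → Digraph r n → Set
_⊆_ {r} {m} {n} F G =
  Σ[ h ∈ (Fin m → Fin n) ]
    Injective _≡_ _≡_ h × (∀ {u} → u ∈ edges F → Vec.map h u ∈ edges G)

-- Vertices and positions are counted from 0, so that the edges are the lists
-- (i, i + 1, …, i + r - 1) for 0 ≤ i ≤ s - r.
module _ (r s : ℕ) where

  window-bound : (i : Fin (suc s ∸ r)) (j : Fin r) → toℕ i + toℕ j < s
  window-bound i j =
    <-≤-trans (+-monoʳ-< (toℕ i) (toℕ<n j)) (m<1+n⇒m≤n
      (m≤o∸n⇒m+n≤o _ (<⇒≤ (m∸n≢0⇒n<m (m<n⇒n≢0 (toℕ<n i)))) (toℕ<n i)))

  window : Fin (suc s ∸ r) → Vec (Fin s) r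
  window i = tabulate (λ j → fromℕ< (window-bound i j))

  toℕ-lookup-window : ∀ i j → toℕ (lookup (window i) j) ≡ toℕ i + toℕ j
  toℕ-lookup-window i j =
    trans (cong toℕ (lookup∘tabulate _ j)) (toℕ-fromℕ< (window-bound i j))

  window-distinct : ∀ i → Vec.Unique (window i)
  window-distinct i = VecUnique.tabulate⁺ λ {j} {k} eq →
    toℕ-injective (+-cancelˡ-≡ (toℕ i) _ _
      (trans (sym (toℕ-fromℕ< (window-bound i j)))
        (trans (cong toℕ eq) (toℕ-fromℕ< (window-bound i k)))))

-- For r = 0 all windows coincide.
window-injective : ∀ r s .{{_ : NonZero r}} → Injective _≡_ _≡_ (window r s)
window-injective r@(suc _) s {i} {k} eq =
  toℕ-injective (+-cancelʳ-≡ 0 _ _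
    (trans (sym (toℕ-lookup-window r s i zero))
      (trans (cong (λ w → toℕ (lookup w zero)) eq) (toℕ-lookup-window r s k zero))))

TightPath : ∀ r s .{{_ : NonZero r}} → Digraph r s
TightPath r s = record
  { edges          = List.map (window r s) (allFin (suc s ∸ r))
  ; edges-unique   = ListUnique.map⁺ (window-injective r s) (ListUnique.allFin⁺ _)
  ; edges-distinct = All.map⁺ (universal (window-distinct r s) _)
  }

{-# OPTIONS --safe #-}

-- Let N = s + r - 1.  Every (r-1)-tuple t has rank ≥ 0, and rank ≥ k + 1 if for at
-- least N vertices w the list w ∷ t is an edge and w ∷ init t has rank ≥ k.  From a
-- tuple of rank ≥ s a path on s + r - 1 vertices is grown greedily at its front.
-- If there is no such tuple, the rank is a function f with s values, and all but
-- N n^(r-1) edges v are ascents: f (init v) < f (tail v).  Around the r rotations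
-- of a tuple the values of f close up, so not all rotations are ascents, and at
-- least two are not if f (init v) = f (tail v).  A quantitative form of the fact
-- that shift graphs have unbounded chromatic number makes this equality hold for
-- a positive proportion of all tuples; hence ∣E∣ ≤ (1 - 1/r - c) n^r + O(n^(r-1)).
module Submission where

open import Data.Bool.Base using (true; false; T)
open import Data.Fin.Base using (Fin; zero; suc; toℕ; fromℕ<; funToFin; finToFun)
import Data.Fin.Properties as Fin
open import Data.Integer.Base using (+_)
import Data.Integer.Base as ℤ
import Data.Integer.Properties as ℤ
import Data.Integer.Tactic.RingSolver as ℤ
open import Data.List.Base as List using (List; []; _∷_; length)
open import Data.List.Membership.DecPropositional using (_∈?_)
open import Data.List.Membership.Propositional using (_∈_)
open import Data.List.Membership.Propositional.Properties using (∈-map⁻)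
import Data.List.Properties as List
open import Data.List.Relation.Unary.All as All using (All)
import Data.List.Relation.Unary.AllPairs as AllPairs
import Data.List.Relation.Unary.Any as Any
import Data.List.Relation.Unary.Unique.Propositional as List
open import Data.Nat.Base
open import Data.Nat.Combinatorics using (_P_)
open import Data.Nat.Combinatorics.Base using (_P′_)
open import Data.Nat.GeneralisedArithmetic using (fold)
open import Data.Nat.Properties
open import Data.Nat.Tactic.RingSolver using (solve-∀)
open import Data.Product.Base using (_×_; _,_; proj₁; proj₂; ∃; ∃-syntax; Σ-syntax)
open import Data.Rational.Base as ℚ using (1ℚ)
import Data.Rational.Properties as ℚ
open import Data.Rational.Unnormalised.Base as ℚᵘ using (mkℚᵘ)
import Data.Rational.Unnormalised.Properties as ℚᵘ
open import Data.Sum.Base using (_⊎_; inj₁; inj₂)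
open import Data.Unit.Base using (⊤; tt)
open import Data.Vec.Base as Vec
  using (Vec; []; _∷_; _∷ʳ_; init; tail; lookup; tabulate; toList)
import Data.Vec.Properties as Vec
import Data.Vec.Relation.Unary.AllPairs as VecAllPairs
import Data.Vec.Relation.Unary.Unique.Propositional as Vec
import Data.Vec.Relation.Unary.Unique.Propositional.Properties as VecUnique
open import Defs
open import Function.Base using (_∘_; _$_)
open import Relation.Binary.Definitions using (DecidableEquality)
open import Relation.Binary.PropositionalEquality
open import Relation.Nullary
open import Relation.Unary using (Decidable)

open import Algebra.Properties.Semiring.Sum +-*-semiring
  using (sum; sum-syntax; sum-cong-≗; ∑-distrib-+; ∑-comm; *-distribˡ-sum; *-distribʳ-sum;
         sum-replicate-zero)

private variable
  k m n : ℕ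
  A Φ Ψ Ω : Set

-- Indicators and sums over `Fin n`.

𝟙 : Dec Φ → ℕ
𝟙 (yes _) = 1
𝟙 (no _)  = 0

𝟙≤1 : (Φ? : Dec Φ) → 𝟙 Φ? ≤ 1
𝟙≤1 (yes _) = ≤-refl
𝟙≤1 (no _)  = z≤n

𝟙-yes : (Φ? : Dec Φ) → Φ → 𝟙 Φ? ≡ 1
𝟙-yes (yes _) _ = refl
𝟙-yes (no ¬p) p = contradiction p ¬p

𝟙-no : (Φ? : Dec Φ) → ¬ Φ → 𝟙 Φ? ≡ 0
𝟙-no (yes p) ¬p = contradiction p ¬p
𝟙-no (no _)  _  = refl

𝟙-mono : (Φ? : Dec Φ) (Ψ? : Dec Ψ) → (Φ → Ψ) → 𝟙 Φ? ≤ 𝟙 Ψ?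
𝟙-mono (yes p) Ψ? f = ≤-reflexive (sym (𝟙-yes Ψ? (f p)))
𝟙-mono (no _)  Ψ? f = z≤n

𝟙-cover : (Φ? : Dec Φ) (Ψ? : Dec Ψ) (Ω? : Dec Ω) → (Φ → Ψ ⊎ Ω) → 𝟙 Φ? ≤ 𝟙 Ψ? + 𝟙 Ω?
𝟙-cover (no _)  Ψ? Ω? f = z≤n
𝟙-cover (yes p) Ψ? Ω? f with f p
... | inj₁ q = ≤-trans (≤-reflexive (sym (𝟙-yes Ψ? q))) (m≤m+n _ _)
... | inj₂ r = ≤-trans (≤-reflexive (sym (𝟙-yes Ω? r))) (m≤n+m _ _)

∑-mono : {F G : Fin n → ℕ} → (∀ i → F i ≤ G i) → sum F ≤ sum G
∑-mono {zero}  h = z≤n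
∑-mono {suc n} h = +-mono-≤ (h zero) (∑-mono (h ∘ suc))

∑-const : ∀ n c → ∑[ i < n ] c ≡ n * c
∑-const zero    c = refl
∑-const (suc n) c = cong (λ x → c + x) (∑-const n c)

∑-bound : {F : Fin n → ℕ} {c : ℕ} → (∀ i → F i ≤ c) → sum F ≤ n * c
∑-bound {n} {c = c} h = ≤-trans (∑-mono h) (≤-reflexive (∑-const n c))

term≤∑ : (F : Fin n → ℕ) (i : Fin n) → F i ≤ sum F
term≤∑ F zero    = m≤m+n _ _
term≤∑ F (suc i) = ≤-trans (term≤∑ (F ∘ suc) i) (m≤n+m _ _)

∑𝟙≟≤1 : (x : Fin n) → ∑[ i < n ] 𝟙 (x Fin.≟ i) ≤ 1
∑𝟙≟≤1 {suc n} zero = s≤s (≤-reflexive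
  (trans (sum-cong-≗ {n} (λ i → 𝟙-no (zero Fin.≟ suc i) λ ())) (sum-replicate-zero n)))
∑𝟙≟≤1 {suc n} (suc x) =
  ≤-trans (∑-mono (λ i → 𝟙-mono (suc x Fin.≟ suc i) (x Fin.≟ i) Fin.suc-injective)) (∑𝟙≟≤1 x)

-- Sums over all tuples.

∑ᵛ : ∀ k → (Vec (Fin n) k → ℕ) → ℕ
∑ᵛ         zero    F = F []
∑ᵛ {n = n} (suc k) F = ∑[ i < n ] ∑ᵛ k (λ v → F (i ∷ v))

∑ᵛ-mono : ∀ k {F G : Vec (Fin n) k → ℕ} → (∀ v → F v ≤ G v) → ∑ᵛ k F ≤ ∑ᵛ k G
∑ᵛ-mono zero    h = h []
∑ᵛ-mono (suc k) h = ∑-mono λ i → ∑ᵛ-mono k (h ∘ (i ∷_))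

∑ᵛ-+ : ∀ k (F G : Vec (Fin n) k → ℕ) → ∑ᵛ k (λ v → F v + G v) ≡ ∑ᵛ k F + ∑ᵛ k G
∑ᵛ-+ zero    F G = refl
∑ᵛ-+ {n = n} (suc k) F G = trans (sum-cong-≗ {n} (λ i → ∑ᵛ-+ k (F ∘ (i ∷_)) (G ∘ (i ∷_))))
  (∑-distrib-+ {n} (λ i → ∑ᵛ k (F ∘ (i ∷_))) (λ i → ∑ᵛ k (G ∘ (i ∷_))))

∑ᵛ-* : ∀ k c (F : Vec (Fin n) k → ℕ) → ∑ᵛ k (λ v → c * F v) ≡ c * ∑ᵛ k F
∑ᵛ-* zero    c F = refl
∑ᵛ-* {n = n} (suc k) c F = trans (sum-cong-≗ {n} (λ i → ∑ᵛ-* k c (F ∘ (i ∷_))))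
  (sym (*-distribˡ-sum {n} c (λ i → ∑ᵛ k (F ∘ (i ∷_)))))

∑ᵛ-const : ∀ k c → ∑ᵛ {n = n} k (λ _ → c) ≡ n ^ k * c
∑ᵛ-const         zero    c = sym (*-identityˡ c)
∑ᵛ-const {n = n} (suc k) c = begin
  ∑[ i < n ] ∑ᵛ {n = n} k (λ _ → c)  ≡⟨ sum-cong-≗ {n} (λ _ → ∑ᵛ-const {n = n} k c) ⟩
  ∑[ i < n ] (n ^ k * c)             ≡⟨ ∑-const n _ ⟩
  n * (n ^ k * c)                    ≡⟨ *-assoc n _ c ⟨
  n * n ^ k * c                      ∎
  where open ≡-Reasoning

∑ᵛ-∑-comm : ∀ k (F : Fin m → Vec (Fin n) k → ℕ) →
  ∑ᵛ k (λ v → ∑[ w < m ] F w v) ≡ ∑[ w < m ] ∑ᵛ k (F w)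
∑ᵛ-∑-comm zero    F = refl
∑ᵛ-∑-comm {m = m} {n = n} (suc k) F =
  trans (sum-cong-≗ {n} (λ i → ∑ᵛ-∑-comm k (λ w v → F w (i ∷ v))))
    (∑-comm {n} {m} (λ i w → ∑ᵛ k (λ v → F w (i ∷ v))))

∑ᵛ-∷ʳ : ∀ k (F : Vec (Fin n) (suc k) → ℕ) →
  ∑ᵛ (suc k) F ≡ ∑ᵛ k (λ v → ∑[ w < n ] F (v ∷ʳ w))
∑ᵛ-∷ʳ zero    F = refl
∑ᵛ-∷ʳ (suc k) F = sum-cong-≗ λ i → ∑ᵛ-∷ʳ k (F ∘ (i ∷_))

term≤∑ᵛ : ∀ k (F : Vec (Fin n) k → ℕ) v → F v ≤ ∑ᵛ k F
term≤∑ᵛ zero    F []      = ≤-refl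
term≤∑ᵛ (suc k) F (i ∷ v) = ≤-trans (term≤∑ᵛ k (F ∘ (i ∷_)) v) (term≤∑ (λ i → ∑ᵛ k (F ∘ (i ∷_))) i)

_≟ᵛ_ : DecidableEquality (Vec (Fin n) k)
_≟ᵛ_ = Vec.≡-dec Fin._≟_

_∈ᵛ?_ : (v : Vec (Fin n) k) (xs : List (Vec (Fin n) k)) → Dec (v ∈ xs)
_∈ᵛ?_ = _∈?_ _≟ᵛ_

-- This turns the number of edges into a sum of indicators. Uniqueness makes the indicators of the
-- head and of the tail disjoint, so that their sum is again an indicator.
length≤∑ᵛ𝟙∈ : (xs : List (Vec (Fin n) k)) → List.Unique xs →
  length xs ≤ ∑ᵛ k (λ v → 𝟙 (v ∈ᵛ? xs))
length≤∑ᵛ𝟙∈ [] _ = z≤n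
length≤∑ᵛ𝟙∈ {n = n} {k = k} (x ∷ xs) (x∉xs AllPairs.∷ u) = begin
  1 + length xs
    ≤⟨ +-mono-≤ 1≤ (length≤∑ᵛ𝟙∈ xs u) ⟩
  ∑ᵛ k (λ v → 𝟙 (x ≟ᵛ v)) + ∑ᵛ k (λ v → 𝟙 (v ∈ᵛ? xs))
    ≡⟨ ∑ᵛ-+ k _ _ ⟨
  ∑ᵛ k (λ v → 𝟙 (x ≟ᵛ v) + 𝟙 (v ∈ᵛ? xs))
    ≤⟨ ∑ᵛ-mono k pointwise ⟩
  ∑ᵛ k (λ v → 𝟙 (v ∈ᵛ? (x ∷ xs))) ∎
  where
  open ≤-Reasoning
  1≤ : 1 ≤ ∑ᵛ k (λ v → 𝟙 (x ≟ᵛ v))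
  1≤ = ≤-trans (≤-reflexive (sym (𝟙-yes (x ≟ᵛ x) refl))) (term≤∑ᵛ k _ x)
  pointwise : ∀ v → 𝟙 (x ≟ᵛ v) + 𝟙 (v ∈ᵛ? xs) ≤ 𝟙 (v ∈ᵛ? (x ∷ xs))
  pointwise v with x ≟ᵛ v
  ... | yes refl = ≤-reflexive (trans (cong suc (𝟙-no (x ∈ᵛ? xs) λ x∈ → All.lookup x∉xs x∈ refl))
                     (sym (𝟙-yes (x ∈ᵛ? (x ∷ xs)) (Any.here refl))))
  ... | no _     = 𝟙-mono (v ∈ᵛ? xs) (v ∈ᵛ? (x ∷ xs)) Any.there

-- Rotations of tuples.

rot : Vec A (suc k) → Vec A (suc k)
rot (x ∷ xs) = xs ∷ʳ x

init-rot : (v : Vec A (suc k)) → init (rot v) ≡ tail v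
init-rot (x ∷ xs) = Vec.init-∷ʳ x xs

-- Rotating moves the outermost summation variable to the innermost place, so this is an exchange of
-- sums.
∑ᵛ-rot : ∀ k (F : Vec (Fin n) (suc k) → ℕ) → ∑ᵛ (suc k) (F ∘ rot) ≡ ∑ᵛ (suc k) F
∑ᵛ-rot k F = trans (sym (∑ᵛ-∑-comm k (λ w v → F (v ∷ʳ w)))) (sym (∑ᵛ-∷ʳ k F))

∑ᵛ-rots : ∀ k i (F : Vec (Fin n) (suc k) → ℕ) →
  ∑ᵛ (suc k) (λ v → F (fold v rot i)) ≡ ∑ᵛ (suc k) F
∑ᵛ-rots k zero    F = refl
∑ᵛ-rots k (suc i) F = trans (∑ᵛ-rots k i (F ∘ rot)) (∑ᵛ-rot k F)

fold-suc : (s : A → A) (z : A) (i : ℕ) → fold z s (suc i) ≡ fold (s z) s i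
fold-suc s z zero    = refl
fold-suc s z (suc i) = cong s (fold-suc s z i)

-- The period of `rot` is found on lists: in the induction of `rotL-++` the two parts change their
-- lengths, which for vectors would require casts.
rotL : List A → List A
rotL []       = []
rotL (x ∷ xs) = xs List.++ List.[ x ]

rotL-++ : (xs ys : List A) → fold (xs List.++ ys) rotL (length xs) ≡ ys List.++ xs
rotL-++ []       ys = sym (List.++-identityʳ ys)
rotL-++ (x ∷ xs) ys = begin
  fold (x ∷ xs List.++ ys) rotL (suc (length xs))             ≡⟨ fold-suc rotL _ (length xs) ⟩
  fold ((xs List.++ ys) List.++ List.[ x ]) rotL (length xs)  ≡⟨ cong (λ zs → fold zs rotL (length xs)) (List.++-assoc xs ys _) ⟩
  fold (xs List.++ (ys List.++ List.[ x ])) rotL (length xs)  ≡⟨ rotL-++ xs _ ⟩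
  (ys List.++ List.[ x ]) List.++ xs                          ≡⟨ List.++-assoc ys _ xs ⟩
  ys List.++ x ∷ xs                                           ∎
  where open ≡-Reasoning

toList-rot : (v : Vec A (suc k)) → toList (rot v) ≡ rotL (toList v)
toList-rot (x ∷ xs) = Vec.toList-∷ʳ x xs

toList-rots : (v : Vec A (suc k)) (i : ℕ) → toList (fold v rot i) ≡ fold (toList v) rotL i
toList-rots v zero    = refl
toList-rots v (suc i) = trans (toList-rot (fold v rot i)) (cong rotL (toList-rots v i))

rot-period : (v : Vec A (suc k)) → fold v rot (suc k) ≡ v
rot-period {k = k} v = trans (sym (Vec.cast-is-id refl _)) (Vec.toList-injective refl _ _ (begin
  toList (fold v rot (suc k))                    ≡⟨ toList-rots v (suc k) ⟩
  fold (toList v) rotL (suc k)                   ≡⟨ cong₂ (λ zs → fold zs rotL) (sym (List.++-identityʳ _)) (sym (Vec.length-toList v)) ⟩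
  fold (toList v List.++ []) rotL (length (toList v)) ≡⟨ rotL-++ (toList v) [] ⟩
  toList v                                       ∎))
  where open ≡-Reasoning

-- Ascents in cyclic sequences.

ascents : ℕ → (ℕ → ℕ) → ℕ
ascents m a = ∑[ i < m ] 𝟙 (a (toℕ i) <? a (suc (toℕ i)))

ascents≤ : ∀ m a → ascents m a ≤ m
ascents≤ m a = ≤-trans (∑-bound {m} (λ i → 𝟙≤1 (a (toℕ i) <? a (suc (toℕ i))))) (≤-reflexive (*-identityʳ m))

ascents<⊎climb : ∀ m a → ascents m a < m ⊎ a 0 + m ≤ a m
ascents<⊎climb zero    a = inj₂ (≤-reflexive (+-identityʳ _))
ascents<⊎climb (suc m) a with a 0 <? a 1 | ascents<⊎climb m (a ∘ suc)
... | no _  | _      = inj₁ (s≤s (ascents≤ m (a ∘ suc)))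
... | yes _ | inj₁ h = inj₁ (s≤s h)
... | yes a₀<a₁ | inj₂ h = inj₂ (≤-trans (≤-reflexive (+-suc _ m)) (≤-trans (+-monoˡ-≤ m a₀<a₁) h))

ascents-cyclic : ∀ m a → a (suc m) ≤ a 0 → ascents (suc m) a < suc m
ascents-cyclic m a h with ascents<⊎climb (suc m) a
... | inj₁ lt = lt
... | inj₂ le = contradiction (≤-trans le h) (m+1+n≰m (a 0))

module _ {q : ℕ} (f : Vec (Fin n) (suc q) → ℕ) where

  ascent level : Vec (Fin n) (2 + q) → ℕ
  ascent v = 𝟙 (f (init v) <? f (tail v))
  level  v = 𝟙 (f (init v) ≟ f (tail v))

  -- Since `init (rot v)` is `tail v`, the rotations compare consecutive terms of one sequence `a`,
  -- which has returned to its start after `2 + q` steps and so cannot ascend at each of them.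
  ascent-rots : ∀ v → (∑[ i < 2 + q ] ascent (fold v rot (toℕ i))) + level v < 2 + q
  ascent-rots v = subst (λ x → x + level v < 2 + q) (sym sum≡) main
    where
    a : ℕ → ℕ
    a i = f (init (fold v rot i))
    step : ∀ i → f (tail (fold v rot i)) ≡ a (suc i)
    step i = cong f (sym (init-rot (fold v rot i)))
    sum≡ : ∑[ i < 2 + q ] ascent (fold v rot (toℕ i)) ≡ ascents (2 + q) a
    sum≡ = sum-cong-≗ {2 + q} λ i → cong (λ x → 𝟙 (a (toℕ i) <? x)) (step (toℕ i))
    period : a (2 + q) ≡ a 0
    period = cong (f ∘ init) (rot-period v)
    main : ascents (2 + q) a + level v < 2 + q
    main with f (init v) ≟ f (tail v)
    ... | no _  = subst (_< 2 + q) (sym (+-identityʳ _)) (ascents-cyclic (suc q) a (≤-reflexive period))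
    -- A level first step is no ascent, and the other `suc q` steps still close up, so that one of
    -- them fails as well.
    ... | yes e = subst (_< 2 + q) eq (s≤s (ascents-cyclic q (a ∘ suc) (≤-reflexive (trans period a₀≡a₁))))
      where
      a₀≡a₁ : a 0 ≡ a 1
      a₀≡a₁ = trans e (step 0)
      eq : suc (ascents (suc q) (a ∘ suc)) ≡ ascents (2 + q) a + 1
      eq = trans (+-comm 1 _) (cong (λ x → x + ascents (suc q) (a ∘ suc) + 1) (sym (𝟙-no (a 0 <? a 1) (<-irrefl a₀≡a₁))))

  -- Sum `ascent-rots` over all `v`; each of the `2 + q` rotations contributes the same total.
  ∑ascent+∑level : (2 + q) * ∑ᵛ (2 + q) ascent + ∑ᵛ (2 + q) level ≤ suc q * n ^ (2 + q)
  ∑ascent+∑level = begin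
    (2 + q) * ∑ᵛ (2 + q) ascent + L
      ≡⟨ cong (_+ L) (∑-const (2 + q) (∑ᵛ (2 + q) ascent)) ⟨
    (∑[ i < 2 + q ] ∑ᵛ (2 + q) ascent) + L
      ≡⟨ cong (_+ L) (sum-cong-≗ {2 + q} (λ i → sym (∑ᵛ-rots (suc q) (toℕ i) ascent))) ⟩
    (∑[ i < 2 + q ] ∑ᵛ (2 + q) (λ v → ascent (fold v rot (toℕ i)))) + L
      ≡⟨ cong (_+ L) (∑ᵛ-∑-comm {m = 2 + q} (2 + q) (λ i v → ascent (fold v rot (toℕ i)))) ⟨
    ∑ᵛ (2 + q) (λ v → ∑[ i < 2 + q ] ascent (fold v rot (toℕ i))) + L
      ≡⟨ ∑ᵛ-+ (2 + q) (λ v → ∑[ i < 2 + q ] ascent (fold v rot (toℕ i))) level ⟨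
    ∑ᵛ (2 + q) (λ v → (∑[ i < 2 + q ] ascent (fold v rot (toℕ i))) + level v)
      ≤⟨ ∑ᵛ-mono (2 + q) (λ v → s≤s⁻¹ (ascent-rots v)) ⟩
    ∑ᵛ {n = n} (2 + q) (λ _ → suc q)
      ≡⟨ ∑ᵛ-const {n = n} (2 + q) (suc q) ⟩
    n ^ (2 + q) * suc q
      ≡⟨ *-comm (n ^ (2 + q)) _ ⟩
    suc q * n ^ (2 + q) ∎
    where
    open ≤-Reasoning
    L = ∑ᵛ (2 + q) level

-- Colourings of shift graphs.

-- The reciprocal is a lower bound for the proportion of tuples on which `init` and `tail` get the
-- same of `s` colours. Each step passes from colours to sets of colours, whence `2 ^ s`.
shiftBound : ℕ → ℕ → ℕ
shiftBound zero    s = 1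
shiftBound (suc k) s = 2 * d * (2 * d * suc s)
  where d = shiftBound k (2 ^ s)

bit : ∀ {P : Set} → Dec P → Fin 2
bit (yes _) = suc zero
bit (no _)  = zero

bit-≡ : ∀ {P Q : Set} (P? : Dec P) (Q? : Dec Q) → bit P? ≡ bit Q? → Q → P
bit-≡ (yes p) Q?      _ _ = p
bit-≡ (no _)  (no ¬q) _ q = contradiction q ¬q

-- A colour c is popular for u if f (w ∷ u) = c for at least n / K of the w.  By
-- induction, init v and tail v have the same popular set for many v;
-- then f v, which is popular for tail v except for few v, is popular for init v,
-- so that f (w ∷ init v) = f v for many w.
module ShiftStep {n k s : ℕ} (f : Vec (Fin n) (suc k) → Fin s) (d : ℕ) where

  -- At most `s` colours are unpopular for `u`, each taken by fewer than `n / K` vertices, which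
  -- makes at most `n / (2 * d)` vertices in all. The factor is `suc s` so that it can be cancelled
  -- even if `s` is 0.
  K : ℕ
  K = 2 * d * suc s

  deg : Vec (Fin n) k → Fin s → ℕ
  deg u c = ∑[ w < n ] 𝟙 (f (w ∷ u) Fin.≟ c)

  popular? : ∀ u c → Dec (n ≤ K * deg u c)
  popular? u c = n ≤? K * deg u c

  -- Sets of colours are coded as numbers, so that this is a colouring of shorter tuples to which
  -- the induction hypothesis applies.
  popularSet : Vec (Fin n) k → Fin (2 ^ s)
  popularSet u = funToFin (λ c → bit (popular? u c))

  popularSet-≡ : ∀ u u′ → popularSet u ≡ popularSet u′ → ∀ c →
    n ≤ K * deg u′ c → n ≤ K * deg u c
  popularSet-≡ u u′ eq c = bit-≡ (popular? u c) (popular? u′ c)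
    (trans (sym (Fin.finToFun-funToFin (λ c → bit (popular? u c)) c))
      (trans (cong (λ g → finToFun {2} {s} g c) eq) (Fin.finToFun-funToFin (λ c → bit (popular? u′ c)) c)))

  same unpopular : Vec (Fin n) (suc k) → ℕ
  same      v = 𝟙 (popularSet (init v) Fin.≟ popularSet (tail v))
  unpopular v = 𝟙 (¬? (popular? (tail v) (f v)))

  unpopular-colour : ∀ u c →
    K * (∑[ w < n ] (𝟙 (f (w ∷ u) Fin.≟ c) * 𝟙 (¬? (popular? u c)))) ≤ n
  unpopular-colour u c = begin
    K * (∑[ w < n ] (𝟙 (f (w ∷ u) Fin.≟ c) * 𝟙 (¬? (popular? u c))))
      ≡⟨ cong (K *_) (*-distribʳ-sum (𝟙 (¬? (popular? u c))) (λ w → 𝟙 (f (w ∷ u) Fin.≟ c))) ⟨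
    K * (deg u c * 𝟙 (¬? (popular? u c)))
      ≤⟨ case ⟩
    n ∎
    where
    open ≤-Reasoning
    case : K * (deg u c * 𝟙 (¬? (popular? u c))) ≤ n
    case with popular? u c
    ... | yes _ = ≤-trans (≤-reflexive (trans (cong (K *_) (*-zeroʳ (deg u c))) (*-zeroʳ K))) z≤n
    ... | no h  = ≤-trans (≤-reflexive (cong (K *_) (*-identityʳ _))) (<⇒≤ (≰⇒> h))

  unpopular-≤ : ∀ u w → unpopular (w ∷ u) ≤
    ∑[ c < s ] (𝟙 (f (w ∷ u) Fin.≟ c) * 𝟙 (¬? (popular? u c)))
  unpopular-≤ u w = begin
    unpopular (w ∷ u) ≡⟨ *-identityˡ _ ⟨
    1 * unpopular (w ∷ u) ≡⟨ cong (_* unpopular (w ∷ u)) (𝟙-yes (x Fin.≟ x) refl) ⟨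
    𝟙 (x Fin.≟ x) * 𝟙 (¬? (popular? u x)) ≤⟨ term≤∑ (λ c → 𝟙 (x Fin.≟ c) * 𝟙 (¬? (popular? u c))) x ⟩
    ∑[ c < s ] (𝟙 (x Fin.≟ c) * 𝟙 (¬? (popular? u c))) ∎
    where
    open ≤-Reasoning
    x = f (w ∷ u)

  few-unpopular : ∀ u → 2 * d * (∑[ w < n ] unpopular (w ∷ u)) ≤ n
  few-unpopular u = *-cancelʳ-≤ _ _ (suc s) $ begin
    2 * d * (∑[ w < n ] unpopular (w ∷ u)) * suc s
      ≡⟨ lem (2 * d) _ (suc s) ⟩
    K * (∑[ w < n ] unpopular (w ∷ u))
      ≤⟨ *-monoʳ-≤ K (∑-mono (unpopular-≤ u)) ⟩
    K * (∑[ w < n ] ∑[ c < s ] X w c)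
      ≡⟨ cong (K *_) (∑-comm X) ⟩
    K * (∑[ c < s ] ∑[ w < n ] X w c)
      ≡⟨ *-distribˡ-sum K (λ c → ∑[ w < n ] X w c) ⟩
    ∑[ c < s ] (K * (∑[ w < n ] X w c))
      ≤⟨ ∑-bound (unpopular-colour u) ⟩
    s * n
      ≤⟨ *-monoˡ-≤ n (n≤1+n s) ⟩
    suc s * n
      ≡⟨ *-comm (suc s) n ⟩
    n * suc s ∎
    where
    open ≤-Reasoning
    X : Fin n → Fin s → ℕ
    X w c = 𝟙 (f (w ∷ u) Fin.≟ c) * 𝟙 (¬? (popular? u c))
    lem : ∀ a b c → a * b * c ≡ a * c * b
    lem = solve-∀

  -- If the popular sets agree, either `f v` is unpopular for `tail v` and the first term pays, or
  -- it is popular for `init v` too and the second term does.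
  same-≤ : ∀ v → n * same v ≤ n * unpopular v + K * deg (init v) (f v)
  same-≤ v with popularSet (init v) Fin.≟ popularSet (tail v) | popular? (tail v) (f v)
  ... | no _  | _     = ≤-trans (≤-reflexive (*-zeroʳ n)) z≤n
  ... | yes _ | no _  = m≤m+n _ _
  ... | yes e | yes p = begin
    n * 1                              ≡⟨ *-identityʳ n ⟩
    n                                  ≤⟨ popularSet-≡ (init v) (tail v) e (f v) p ⟩
    K * deg (init v) (f v)             ≤⟨ m≤n+m _ _ ⟩
    n * 0 + K * deg (init v) (f v)     ∎
    where open ≤-Reasoning

  step : n ^ suc k ≤ d * ∑ᵛ (suc k) same →
    n ^ (2 + k) ≤ 2 * d * K * ∑ᵛ (2 + k) (λ v → 𝟙 (f (init v) Fin.≟ f (tail v)))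
  -- The induction hypothesis gives a proportion `1 / d` of tuples with equal popular sets.
  -- Unpopular tuples use up at most half of it; the added `n * M` stands for that half.
  step ih = +-cancelˡ-≤ (n * M) _ _ $ begin
    n * M + n * M                        ≡⟨ lem₁ n M ⟩
    2 * n * M                            ≤⟨ *-monoʳ-≤ (2 * n) ih ⟩
    2 * n * (d * S)                      ≡⟨ lem₂ n d S ⟩
    2 * d * (n * S)                      ≤⟨ *-monoʳ-≤ (2 * d) sumd ⟩
    2 * d * (n * U + K * W)              ≡⟨ lem₃ d n U K W ⟩
    n * (2 * d * U) + 2 * d * K * W      ≤⟨ +-monoˡ-≤ _ (*-monoʳ-≤ n U≤) ⟩
    n * M + 2 * d * K * W                ∎
    where
    open ≤-Reasoning
    M = n ^ suc k
    S = ∑ᵛ (suc k) same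
    U = ∑ᵛ (suc k) unpopular
    W = ∑ᵛ (2 + k) (λ v → 𝟙 (f (init v) Fin.≟ f (tail v)))
    lem₁ : ∀ n M → n * M + n * M ≡ 2 * n * M
    lem₁ = solve-∀
    lem₂ : ∀ n d S → 2 * n * (d * S) ≡ 2 * d * (n * S)
    lem₂ = solve-∀
    lem₃ : ∀ d n U K W → 2 * d * (n * U + K * W) ≡ n * (2 * d * U) + 2 * d * K * W
    lem₃ = solve-∀
    U≤ : 2 * d * U ≤ M
    U≤ = begin
      2 * d * U
        ≡⟨ cong (2 * d *_) (∑ᵛ-∑-comm k (λ w u → unpopular (w ∷ u))) ⟨
      2 * d * ∑ᵛ k (λ u → ∑[ w < n ] unpopular (w ∷ u))
        ≡⟨ ∑ᵛ-* k (2 * d) _ ⟨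
      ∑ᵛ k (λ u → 2 * d * (∑[ w < n ] unpopular (w ∷ u)))
        ≤⟨ ∑ᵛ-mono k few-unpopular ⟩
      ∑ᵛ {n = n} k (λ _ → n)
        ≡⟨ trans (∑ᵛ-const {n = n} k n) (*-comm (n ^ k) n) ⟩
      M ∎
    sumd : n * S ≤ n * U + K * W
    sumd = begin
      n * S
        ≡⟨ ∑ᵛ-* (suc k) n same ⟨
      ∑ᵛ (suc k) (λ v → n * same v)
        ≤⟨ ∑ᵛ-mono (suc k) same-≤ ⟩
      ∑ᵛ (suc k) (λ v → n * unpopular v + K * deg (init v) (f v))
        ≡⟨ ∑ᵛ-+ (suc k) (λ v → n * unpopular v) (λ v → K * deg (init v) (f v)) ⟩
      ∑ᵛ (suc k) (λ v → n * unpopular v) + ∑ᵛ (suc k) (λ v → K * deg (init v) (f v))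
        ≡⟨ cong₂ _+_ (∑ᵛ-* (suc k) n unpopular) (∑ᵛ-* (suc k) K (λ v → deg (init v) (f v))) ⟩
      n * U + K * ∑ᵛ (suc k) (λ v → deg (init v) (f v))
        -- A pair of `v` and a `w` counted by its degree is a tuple `w ∷ v` with equally coloured
        -- `init` and `tail`.
        ≡⟨ cong (λ x → n * U + K * x) (∑ᵛ-∑-comm (suc k) (λ w v → 𝟙 (f (w ∷ init v) Fin.≟ f v))) ⟩
      n * U + K * W ∎

many-shift-equal : ∀ k s (f : Vec (Fin n) k → Fin s) →
  n ^ suc k ≤ shiftBound k s * ∑ᵛ (suc k) (λ v → 𝟙 (f (init v) Fin.≟ f (tail v)))
many-shift-equal {n = n} zero    s f = ≤-reflexive (trans (sym (∑-const n 1)) (trans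
  (sum-cong-≗ {n} (λ _ → sym (𝟙-yes (f [] Fin.≟ f []) refl))) (sym (*-identityˡ _))))
many-shift-equal (suc k) s f = step (many-shift-equal k (2 ^ s) popularSet)
  where open ShiftStep f (shiftBound k (2 ^ s))

-- Choosing new vertices and finite searches.

-- Otherwise every `w` satisfying `P` is some `p i`, and counting the pairs with `p i ≡ w` in two
-- ways leaves at most `m` such `w`.
fresh : {P : Fin n → Set} (P? : Decidable P) (p : Fin m → Fin n) →
  m < ∑[ w < n ] 𝟙 (P? w) → ∃[ w ] P w × (∀ i → p i ≢ w)
fresh {n} {m} P? p m<P with Fin.any? (λ w → P? w ×-dec Fin.all? (λ i → ¬? (p i Fin.≟ w)))
... | yes found = found
... | no none   = contradiction (≤-trans m<P P≤m) (<-irrefl refl)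
  where
  open ≤-Reasoning
  hit : ∀ w → 𝟙 (P? w) ≤ ∑[ i < m ] 𝟙 (p i Fin.≟ w)
  hit w with P? w
  ... | no _   = z≤n
  ... | yes Pw with Fin.any? (λ i → p i Fin.≟ w)
  ...   | yes (i , e) = ≤-trans (≤-reflexive (sym (𝟙-yes (p i Fin.≟ w) e)))
                          (term≤∑ (λ i → 𝟙 (p i Fin.≟ w)) i)
  ...   | no  ∄i      = contradiction (w , Pw , λ i e → ∄i (i , e)) none
  P≤m : ∑[ w < n ] 𝟙 (P? w) ≤ m
  P≤m = begin
    ∑[ w < n ] 𝟙 (P? w)                      ≤⟨ ∑-mono hit ⟩
    ∑[ w < n ] ∑[ i < m ] 𝟙 (p i Fin.≟ w)    ≡⟨ ∑-comm (λ w i → 𝟙 (p i Fin.≟ w)) ⟩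
    ∑[ i < m ] ∑[ w < n ] 𝟙 (p i Fin.≟ w)    ≤⟨ ∑-bound (λ i → ∑𝟙≟≤1 (p i)) ⟩
    m * 1                                    ≡⟨ *-identityʳ m ⟩
    m                                        ∎

-- The least failure is used, so that Rank k need not be shown to be antitone in k.
firstFailure : (P : ℕ → Set) → Decidable P → P 0 → ∀ s → ¬ P s →
  Σ[ i ∈ Fin s ] (∀ k → k ≤ toℕ i → P k) × ¬ P (suc (toℕ i))
firstFailure P P? P0 zero    ¬Ps = contradiction P0 ¬Ps
firstFailure P P? P0 (suc s) ¬Ps with P? 1
... | no ¬P1 = zero , (λ { _ z≤n → P0 }) , ¬P1
... | yes P1 with i , below , fails ← firstFailure (P ∘ suc) (P? ∘ suc) P1 s ¬Ps =
  suc i , (λ { zero _ → P0 ; (suc k) (s≤s h) → below k h }) , fails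

anyVec? : ∀ k {P : Vec (Fin n) k → Set} → Decidable P → Dec (∃ P)
anyVec? zero P? with P? []
... | yes p = yes ([] , p)
... | no ¬p = no λ { ([] , p) → ¬p p }
anyVec? (suc k) P? with Fin.any? (λ i → anyVec? k (P? ∘ (i ∷_)))
... | yes (i , v , p) = yes (i ∷ v , p)
... | no none = no λ { (i ∷ v , p) → none (i , v , p) }

-- Vertex sequences as functions on `ℕ`.

segment : ∀ m → (ℕ → A) → ℕ → Vec A m
segment m p i = tabulate (λ j → p (i + toℕ j))

cons : A → (ℕ → A) → ℕ → A
cons w p zero    = w
cons w p (suc i) = p i

init-tabulate : ∀ m (g : ℕ → A) → init (tabulate {n = suc m} (g ∘ toℕ)) ≡ tabulate {n = m} (g ∘ toℕ)
init-tabulate zero    g = refl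
init-tabulate (suc m) g = cong (g 0 ∷_) (init-tabulate m (g ∘ suc))

-- Beyond the end of the vector the last entry is repeated; those values play no role.
extend : Vec A (suc m) → ℕ → A
extend (x ∷ _)      zero    = x
extend (x ∷ [])     (suc _) = x
extend (_ ∷ y ∷ xs) (suc i) = extend (y ∷ xs) i

extend-lookup : (t : Vec A (suc m)) (i : Fin (suc m)) → extend t (toℕ i) ≡ lookup t i
extend-lookup (x ∷ _)      zero    = refl
extend-lookup (_ ∷ y ∷ xs) (suc i) = extend-lookup (y ∷ xs) i

extend-injective : (t : Vec A (suc m)) → Vec.Unique t →
  ∀ {i j} → i < suc m → j < suc m → extend t i ≡ extend t j → i ≡ j
extend-injective {m = m} t u i< j< eq = Fin.fromℕ<-injective _ _ i< j<
  (VecUnique.lookup-injective u _ _ (trans (sym (at i<)) (trans eq (at j<))))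
  where
  at : ∀ {i} (i< : i < suc m) → extend t i ≡ lookup t (fromℕ< i<)
  at i< = trans (cong (extend t) (sym (Fin.toℕ-fromℕ< i<))) (extend-lookup t (fromℕ< i<))

-- Ranks and the greedy path.

module Greedy {n q : ℕ} {E : Vec (Fin n) (2 + q) → Set} (E? : Decidable E) (N : ℕ) where

  mutual
    Rank : ℕ → Vec (Fin n) (suc q) → Set
    Rank zero    t = ⊤
    Rank (suc k) t = N ≤ ∑[ w < n ] 𝟙 (extends? k t w)

    extends? : ∀ k t w → Dec (E (w ∷ t) × Rank k (w ∷ init t))
    extends? k t w = E? (w ∷ t) ×-dec rank? k (w ∷ init t)

    rank? : ∀ k t → Dec (Rank k t)
    rank? zero    t = yes tt
    rank? (suc k) t = N ≤? ∑[ w < n ] 𝟙 (extends? k t w)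

  -- Here `k` counts edges, and the vertices are the first `k + suc q` values of `p`. A total
  -- function lets the path grow at its front without casts.
  record IsPath (k : ℕ) (p : ℕ → Fin n) : Set where
    field
      distinct : ∀ {i j} → i < k + suc q → j < k + suc q → p i ≡ p j → i ≡ j
      edge     : ∀ i → i < k → E (segment (2 + q) p i)

  cons-path : ∀ {k p w} → IsPath k p → E (w ∷ segment (suc q) p 0) →
    (∀ {i} → i < k + suc q → p i ≢ w) → IsPath (suc k) (cons w p)
  cons-path {k} {p} {w} path e new = record { distinct = distinct′ ; edge = edge′ }
    where
    open IsPath path
    distinct′ : ∀ {i j} → i < suc k + suc q → j < suc k + suc q → cons w p i ≡ cons w p j → i ≡ j
    distinct′ {zero}  {zero}  _ _ _ = refl
    distinct′ {zero}  {suc j} _ j< eq = contradiction (sym eq) (new (s≤s⁻¹ j<))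
    distinct′ {suc i} {zero}  i< _ eq = contradiction eq (new (s≤s⁻¹ i<))
    distinct′ {suc i} {suc j} i< j< eq = cong suc (distinct (s≤s⁻¹ i<) (s≤s⁻¹ j<) eq)
    edge′ : ∀ i → i < suc k → E (segment (2 + q) (cons w p) i)
    edge′ zero    _  = e
    edge′ (suc i) i< = edge i (s≤s⁻¹ i<)

  -- Each step trades one unit of rank for one edge. While rank is left, the path has fewer than `N`
  -- vertices, so one of the at least `N` admissible vertices lies off it.
  grow : ∀ m k p → IsPath k p → Rank m (segment (suc q) p 0) → m + k + suc q ≤ N →
    ∃[ p′ ] IsPath (m + k) p′
  grow zero    k p path _    _    = p , path
  grow (suc m) k p path rank room
    with w , (e , rank′) , new ← fresh (extends? m (segment (suc q) p 0)) (p ∘ toℕ {k + suc q})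
           (≤-trans (s≤s (+-monoˡ-≤ (suc q) (m≤n+m k m))) (≤-trans room rank))
    with p′ , path′ ← grow m (suc k) (cons w p)
           (cons-path path e λ i< → subst (λ j → p j ≢ w) (Fin.toℕ-fromℕ< i<) (new (fromℕ< i<)))
           (subst (Rank m) (cong (w ∷_) (init-tabulate q p)) rank′)
           (subst (λ j → j + suc q ≤ N) (sym (+-suc m k)) room)
    = p′ , subst (λ j → IsPath j p′) (+-suc m k) path′

  rank⇒path : (∀ {v} → E v → Vec.Unique v) → ∀ s t → Rank (suc s) t → suc s + suc q ≤ N →
    ∃[ p ] IsPath (suc s) p
  rank⇒path E-unique s t rank room
    -- Positive rank yields an edge `w ∷ t`, which shows that the entries of `t` are distinct; `t`
    -- is then the initial path with no edges.
    with w , (e , _) , _ ← fresh {m = 0} (extends? s t) (λ ()) (≤-trans (s≤s z≤n) (≤-trans room rank))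
    with _ VecAllPairs.∷ t-unique ← E-unique e
    with p , path ← grow (suc s) 0 (extend t) (record { distinct = extend-injective t t-unique ; edge = λ _ () })
           (subst (Rank (suc s)) (trans (sym (Vec.tabulate∘lookup t))
             (Vec.tabulate-cong (λ i → sym (extend-lookup t i)))) rank)
           (subst (λ j → j + suc q ≤ N) (sym (+-identityʳ (suc s))) room)
    = p , subst (λ j → IsPath j p) (+-identityʳ (suc s)) path

  module _ {s : ℕ} (unranked : ∀ t → ¬ Rank s t) where

    failure : ∀ t → Σ[ i ∈ Fin s ] (∀ k → k ≤ toℕ i → Rank k t) × ¬ Rank (suc (toℕ i)) t
    failure t = firstFailure (λ k → Rank k t) (λ k → rank? k t) tt s (unranked t)

    colour : Vec (Fin n) (suc q) → Fin s
    colour t = proj₁ (failure t)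

    height : Vec (Fin n) (suc q) → ℕ
    height t = toℕ (colour t)

    exceptional? : ∀ v → Dec (E v × height (tail v) ≤ height (init v))
    exceptional? v = E? v ×-dec (height (tail v) ≤? height (init v))

    -- If `w ∷ t` is exceptional, then `w ∷ init t` has every rank up to `height t`, so `w` counts
    -- towards the next rank of `t`. That rank fails, so there are fewer than `N` such `w`.
    few-exceptional : ∑ᵛ (2 + q) (λ v → 𝟙 (exceptional? v)) ≤ n ^ suc q * N
    few-exceptional = begin
      ∑ᵛ (2 + q) (λ v → 𝟙 (exceptional? v))
        ≡⟨ ∑ᵛ-∑-comm (suc q) (λ w t → 𝟙 (exceptional? (w ∷ t))) ⟨
      ∑ᵛ (suc q) (λ t → ∑[ w < n ] 𝟙 (exceptional? (w ∷ t)))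
        ≤⟨ ∑ᵛ-mono (suc q) fewer-than-N ⟩
      ∑ᵛ {n = n} (suc q) (λ _ → N)
        ≡⟨ ∑ᵛ-const {n = n} (suc q) N ⟩
      n ^ suc q * N ∎
      where
      open ≤-Reasoning
      fewer-than-N : ∀ t → ∑[ w < n ] 𝟙 (exceptional? (w ∷ t)) ≤ N
      fewer-than-N t = ≤-trans
        (∑-mono λ w → 𝟙-mono (exceptional? (w ∷ t)) (extends? (height t) t w)
          λ (e , h) → e , proj₁ (proj₂ (failure (w ∷ init t))) (height t) h)
        (<⇒≤ (≰⇒> (proj₂ (proj₂ (failure t)))))

    ∑E≤ : ∑ᵛ (2 + q) (λ v → 𝟙 (E? v)) ≤ ∑ᵛ (2 + q) (ascent height) + n ^ suc q * N
    ∑E≤ = begin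
      ∑ᵛ (2 + q) (λ v → 𝟙 (E? v))
        ≤⟨ ∑ᵛ-mono (2 + q) (λ v → 𝟙-cover (E? v) (height (init v) <? height (tail v)) (exceptional? v) (cover v)) ⟩
      ∑ᵛ (2 + q) (λ v → ascent height v + 𝟙 (exceptional? v))
        ≡⟨ ∑ᵛ-+ (2 + q) (ascent height) (λ v → 𝟙 (exceptional? v)) ⟩
      ∑ᵛ (2 + q) (ascent height) + ∑ᵛ (2 + q) (λ v → 𝟙 (exceptional? v))
        ≤⟨ +-monoʳ-≤ (∑ᵛ (2 + q) (ascent height)) few-exceptional ⟩
      ∑ᵛ (2 + q) (ascent height) + n ^ suc q * N ∎
      where
      open ≤-Reasoning
      cover : ∀ v → E v → height (init v) < height (tail v) ⊎ E v × height (tail v) ≤ height (init v)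
      cover v e with height (init v) <? height (tail v)
      ... | yes h = inj₁ h
      ... | no h  = inj₂ (e , ≮⇒≥ h)

    many-level : n ^ (2 + q) ≤ shiftBound (suc q) s * ∑ᵛ (2 + q) (level height)
    many-level = ≤-trans (many-shift-equal (suc q) s colour) (*-monoʳ-≤ (shiftBound (suc q) s)
      (∑ᵛ-mono (2 + q) λ v → 𝟙-mono (colour (init v) Fin.≟ colour (tail v))
        (height (init v) ≟ height (tail v)) (cong toℕ)))

-- Falling factorials and the density hypothesis.

P′≤^ : ∀ n k → n P′ k ≤ n ^ k
P′≤^ n zero    = ≤-refl
P′≤^ n (suc k) = *-mono-≤ (m∸n≤m n k) (P′≤^ n k)

-- Lowering the next factor from `n` to `n ∸ suc k` costs at most `suc k * n ^ suc k`; the growth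
-- from one square to the next covers this.
^≤P′+ : ∀ n k → n ^ suc k ≤ n P′ suc k + suc k * suc k * n ^ k
^≤P′+ n zero    = m≤m+n _ _
^≤P′+ n (suc k) = begin
  n * n ^ suc k
    ≤⟨ *-monoʳ-≤ n (^≤P′+ n k) ⟩
  n * (F + suc k * suc k * n ^ k)
    ≡⟨ lem₁ n F k (n ^ k) ⟩
  n * F + suc k * suc k * n ^ suc k
    ≤⟨ +-monoˡ-≤ _ (*-monoˡ-≤ F (m≤n+m∸n n (suc k))) ⟩
  (suc k + (n ∸ suc k)) * F + suc k * suc k * n ^ suc k
    ≡⟨ lem₂ k (n ∸ suc k) F (n ^ suc k) ⟩
  (n ∸ suc k) * F + suc k * F + suc k * suc k * n ^ suc k
    ≤⟨ +-monoˡ-≤ _ (+-monoʳ-≤ ((n ∸ suc k) * F) (*-monoʳ-≤ (suc k) (P′≤^ n (suc k)))) ⟩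
  (n ∸ suc k) * F + suc k * n ^ suc k + suc k * suc k * n ^ suc k
    ≤⟨ m≤m+n _ _ ⟩
  (n ∸ suc k) * F + suc k * n ^ suc k + suc k * suc k * n ^ suc k + (2 + k) * n ^ suc k
    ≡⟨ lem₃ ((n ∸ suc k) * F) k (n ^ suc k) ⟩
  (n ∸ suc k) * F + (2 + k) * (2 + k) * n ^ suc k ∎
  where
  open ≤-Reasoning
  F = n P′ suc k
  lem₁ : ∀ n F k M → n * (F + suc k * suc k * M) ≡ n * F + suc k * suc k * (n * M)
  lem₁ = solve-∀
  lem₂ : ∀ k d F M → (suc k + d) * F + suc k * suc k * M ≡ d * F + suc k * F + suc k * suc k * M
  lem₂ = solve-∀
  lem₃ : ∀ d k M → d + suc k * M + suc k * suc k * M + (2 + k) * M ≡ d + (2 + k) * (2 + k) * M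
  lem₃ = solve-∀

P≡P′ : ∀ {n k} → k ≤ n → n P k ≡ n P′ k
P≡P′ {n} {k} k≤n with k ≤ᵇ n in eq
... | true  = refl
... | false = contradiction (≤⇒≤ᵇ k≤n) (subst T eq)

-- Denominators are cleared among the unnormalised rationals, where the order is an integer
-- inequality with no reduction to lowest terms.
density⇒ : ∀ q e f → (+ e ℚ./ 1) ℚ.≥ (1ℚ ℚ.- (+ 1 ℚ./ suc q)) ℚ.* (+ f ℚ./ 1) → q * f ≤ suc q * e
density⇒ q e f h = ℤ.drop‿+≤+ (subst₂ ℤ._≤_ lhs rhs (ℚᵘ.drop-*≤* unnormalised))
  where
  open ℚᵘ.≤-Reasoning
  unnormalised : (ℚᵘ.1ℚᵘ ℚᵘ.- mkℚᵘ (+ 1) q) ℚᵘ.* mkℚᵘ (+ f) 0 ℚᵘ.≤ mkℚᵘ (+ e) 0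
  unnormalised = begin
    (ℚᵘ.1ℚᵘ ℚᵘ.- mkℚᵘ (+ 1) q) ℚᵘ.* mkℚᵘ (+ f) 0
      ≃⟨ ℚᵘ.*-cong (ℚᵘ.+-cong (ℚᵘ.≃-refl {ℚᵘ.1ℚᵘ}) (ℚᵘ.-‿cong (ℚ.toℚᵘ-fromℚᵘ (mkℚᵘ (+ 1) q)))) (ℚ.toℚᵘ-fromℚᵘ (mkℚᵘ (+ f) 0)) ⟨
    (ℚᵘ.1ℚᵘ ℚᵘ.- ℚ.toℚᵘ x) ℚᵘ.* ℚ.toℚᵘ y
      ≃⟨ ℚᵘ.*-congʳ (ℚᵘ.+-congʳ ℚᵘ.1ℚᵘ (ℚ.toℚᵘ-homo‿- x)) ⟨
    (ℚᵘ.1ℚᵘ ℚᵘ.+ ℚ.toℚᵘ (ℚ.- x)) ℚᵘ.* ℚ.toℚᵘ y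
      ≃⟨ ℚᵘ.*-congʳ (ℚ.toℚᵘ-homo-+ 1ℚ (ℚ.- x)) ⟨
    ℚ.toℚᵘ (1ℚ ℚ.- x) ℚᵘ.* ℚ.toℚᵘ y
      ≃⟨ ℚ.toℚᵘ-homo-* (1ℚ ℚ.- x) y ⟨
    ℚ.toℚᵘ ((1ℚ ℚ.- x) ℚ.* y)
      ≤⟨ ℚ.toℚᵘ-mono-≤ h ⟩
    ℚ.toℚᵘ (+ e ℚ./ 1)
      ≃⟨ ℚ.toℚᵘ-fromℚᵘ (mkℚᵘ (+ e) 0) ⟩
    mkℚᵘ (+ e) 0 ∎
    where
    x = + 1 ℚ./ suc q
    y = + f ℚ./ 1
  lem : ∀ q f → (+ 1 ℤ.* (+ 1 ℤ.+ q) ℤ.+ ℤ.- (+ 1) ℤ.* + 1) ℤ.* f ℤ.* + 1 ≡ q ℤ.* f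
  lem = ℤ.solve-∀
  lhs : (+ 1 ℤ.* (+ suc q) ℤ.+ ℤ.- (+ 1) ℤ.* + 1) ℤ.* + f ℤ.* + 1 ≡ + (q * f)
  lhs = trans (lem (+ q) (+ f)) (sym (ℤ.pos-* q f))
  rhs : + e ℤ.* + (suc (q + 0) * 1) ≡ + (suc q * e)
  rhs = trans (sym (ℤ.pos-* e _)) (cong +_ (trans (*-comm e _) (cong (_* e) (trans (*-identityʳ _) (cong suc (+-identityʳ q))))))

-- The threshold and the embedding.

-- The second factor bounds the number of level tuples in units of `n ^ suc q`: its first summand
-- comes from exceptional edges, its second from replacing the falling factorial by a power.
threshold : ℕ → ℕ → ℕ
threshold q s = shiftBound (suc q) s * ((2 + q) * (s + suc q) + suc q * ((2 + q) * (2 + q)))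

module _ {q n : ℕ} (G : Digraph (2 + q) n) (s : ℕ) where

  private
    r = 2 + q
    N = suc s + suc q
    M = n ^ suc q
    C = r * N + suc q * (r * r)
    D = shiftBound (suc q) (suc s)

  open Greedy {E = _∈ edges G} (_∈ᵛ? edges G) N

  -- The level tuples number at least `n * M / D` by the shift graph bound and at most `C * M` by
  -- the density of `G`.
  unranked⇒small : (∀ t → ¬ Rank (suc s) t) → .{{NonZero n}} → r ≤ n →
    suc q * (n P r) ≤ r * ∣E G ∣ → n ≤ threshold q (suc s)
  unranked⇒small unranked r≤n dense = *-cancelʳ-≤ n (D * C) M {{m^n≢0 n (suc q)}} $ begin
    n * M                ≤⟨ many-level unranked ⟩
    D * levels           ≤⟨ *-monoʳ-≤ D levels≤ ⟩
    D * (C * M)          ≡⟨ *-assoc D C M ⟨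
    D * C * M            ∎
    where
    open ≤-Reasoning
    h = height unranked
    ascents′ = ∑ᵛ r (ascent h)
    levels   = ∑ᵛ r (level h)
    ∣E∣≤ : ∣E G ∣ ≤ ascents′ + M * N
    ∣E∣≤ = ≤-trans (length≤∑ᵛ𝟙∈ (edges G) (edges-unique G)) (∑E≤ unranked)
    expand : ∀ r a M N R q → r * (a + M * N) + q * (R * M) ≡ r * a + (r * N + q * R) * M
    expand = solve-∀
    levels≤ : levels ≤ C * M
    -- The cyclic bound and the density hypothesis share the main term `suc q * n ^ r`, so the level
    -- tuples must fit into errors of order `M`.
    levels≤ = +-cancelˡ-≤ (r * ascents′) _ _ $ begin
      r * ascents′ + levels
        ≤⟨ ∑ascent+∑level h ⟩
      suc q * n ^ r
        ≤⟨ *-monoʳ-≤ (suc q) (^≤P′+ n (suc q)) ⟩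
      suc q * (n P′ r + r * r * M)
        ≡⟨ *-distribˡ-+ (suc q) (n P′ r) (r * r * M) ⟩
      suc q * (n P′ r) + suc q * (r * r * M)
        ≡⟨ cong (λ x → suc q * x + suc q * (r * r * M)) (P≡P′ r≤n) ⟨
      suc q * (n P r) + suc q * (r * r * M)
        ≤⟨ +-monoˡ-≤ _ dense ⟩
      r * ∣E G ∣ + suc q * (r * r * M)
        ≤⟨ +-monoˡ-≤ _ (*-monoʳ-≤ r ∣E∣≤) ⟩
      r * (ascents′ + M * N) + suc q * (r * r * M)
        ≡⟨ expand r ascents′ M N (r * r) (suc q) ⟩
      r * ascents′ + C * M ∎

  path-exists : r ≤ n → threshold q (suc s) < n → suc q * (n P r) ≤ r * ∣E G ∣ →
    ∃[ p ] IsPath (suc s) p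
  path-exists r≤n large dense with anyVec? (suc q) (rank? (suc s))
  ... | yes (t , ranked) = rank⇒path (All.lookup (edges-distinct G)) s t ranked ≤-refl
  ... | no none = contradiction
    (unranked⇒small (λ t ranked → none (t , ranked)) {{>-nonZero (≤-trans (s≤s z≤n) large)}} r≤n dense)
    (<⇒≱ large)

corollary33 : ∀ (r s : ℕ) .{{_ : NonZero r}} .{{_ : NonZero s}} → 2 ≤ r →
    ∃[ n₀ ] ∀ (n : ℕ) → n₀ ≤ n → (G : Digraph r n) →
    (+ ∣E G ∣ ℚ./ 1) ℚ.≥ (1ℚ ℚ.- (+ 1 ℚ./ r)) ℚ.* (+ (n P r) ℚ./ 1) →
    TightPath r s ⊆ G
corollary33 (suc (suc q)) (suc s) (s≤s (s≤s z≤n)) = 2 + q + suc (threshold q (suc s)) , embed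
  where
  embed : ∀ n → 2 + q + suc (threshold q (suc s)) ≤ n → (G : Digraph (2 + q) n) →
    (+ ∣E G ∣ ℚ./ 1) ℚ.≥ (1ℚ ℚ.- (+ 1 ℚ./ (2 + q))) ℚ.* (+ (n P (2 + q)) ℚ./ 1) →
    TightPath (2 + q) (suc s) ⊆ G
  embed n n₀≤n G dense
    with p , path ← path-exists G s (m+n≤o⇒m≤o (2 + q) n₀≤n) (m+n≤o⇒n≤o (2 + q) n₀≤n)
           (density⇒ (suc q) ∣E G ∣ (n P (2 + q)) dense)
    = p ∘ toℕ , injective , preserves
    where
    open Greedy.IsPath path
    -- The path has `suc s` edges; its first `suc s` vertices form the required copy, whose windows
    -- all start below `suc s`.
    within : (i : Fin (suc s)) → toℕ i < suc s + suc q
    within i = <-≤-trans (Fin.toℕ<n i) (m≤m+n _ _)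
    injective : ∀ {i j : Fin (suc s)} → p (toℕ i) ≡ p (toℕ j) → i ≡ j
    injective {i} {j} eq = Fin.toℕ-injective (distinct (within i) (within j) eq)
    preserves : ∀ {u} → u ∈ edges (TightPath (2 + q) (suc s)) → Vec.map (p ∘ toℕ) u ∈ edges G
    preserves u∈ with i , _ , refl ← ∈-map⁻ (window (2 + q) (suc s)) u∈ =
      subst (_∈ edges G) (trans
        (Vec.tabulate-cong (λ j → cong p (sym (Fin.toℕ-fromℕ< (window-bound (2 + q) (suc s) i j)))))
        (Vec.tabulate-∘ (p ∘ toℕ) (λ j → fromℕ< (window-bound (2 + q) (suc s) i j))))
        (edge (toℕ i) (subst (_< suc s) (+-identityʳ _) (window-bound (2 + q) (suc s) i zero)))
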